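{- For every real $\alpha$ with $0<\alpha<\frac14$, there exists a positive integer $n$ such that $\alpha n$ is an integer and every red/blue edge-coloring of the Kneser graph $\mathrm{KG}(n,\alpha n)$ contains a monochromatic triangle.
   Context: The Kneser graph $\mathrm{KG}(n,r)$ has as vertex set all $r$-element subsets of $[n]=\{1,\dots,n\}$, two such sets being adjacent if and only if they are disjoint. A monochromatic triangle is a set of three pairwise adjacent vertices whose three connecting edges all have the same color.
   Formalization: The number α is taken rational instead of real; for irrational α no positive integer n makes αn an integer, so the claim as worded fails there and no true case is lost. The number α is taken to be rational: for irrational α (for example α = √2/8) no positive integer n makes αn an integer, so the statement as worded for every real α fails there; all rational α with 0 < α < 1/4 are covered. -}

module Defs where

open import Data.Nat using (ℕ)
open import Data.Bool using (Bool)
open import Data.Product using (Σ; _×_; ∃-syntax; _,_)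
open import Data.Fin.Subset using (Subset; ∣_∣; _∩_; Empty)
open import Relation.Binary.PropositionalEquality using (_≡_)

KVertex : ℕ → ℕ → Set
KVertex n r = Σ (Subset n) (λ s → ∣ s ∣ ≡ r)

KAdj : ∀ {n r} → KVertex n r → KVertex n r → Set
KAdj (s , _) (t , _) = Empty (s ∩ t)

record EdgeColoring (n r : ℕ) : Set where
  field
    colour : KVertex n r → KVertex n r → Bool
    symmetric : ∀ u v → KAdj u v → colour u v ≡ colour v u

MonoTriangle : ∀ {n r} → EdgeColoring n r → Set
MonoTriangle {n} {r} c =
  ∃[ u ] ∃[ v ] ∃[ w ]
    (KAdj u v × KAdj v w × KAdj u w ×
     colour u v ≡ colour v w × colour u v ≡ colour u w)
  where open EdgeColoring c

{-# OPTIONS --safe #-}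
-- Fix a vertex A of KG(n, r) with n ≥ 4r + 2. If three pairwise disjoint vertices
-- outside A are all joined to A in the same colour b, then either one of the three
-- edges among them has colour b and closes a triangle with A, or the three form a
-- triangle in the other colour. So it suffices that a two-colouring of the
-- r-subsets of a set of size at least 3r + 2 admits three disjoint r-sets of the same
-- colour.
--
-- More generally, a set of size at least (k + 1)r + k contains k + 1 disjoint
-- r-sets of the same colour. List its elements: if all windows of r consecutive
-- elements have the same colour, cut the list into windows. Otherwise two windows
-- shifted by one differ in colour; delete their union, of size r + 1, find k sets of
-- a common colour among the remaining elements, and add the window of that colour.
--
-- For α = p/q < 1/4 take n = 2q and r = 2p: then q ≥ 4p + 1 gives n ≥ 4r + 2.
module Submission where

open import Defs
open import Data.Nat using (ℕ; _<_; zero; suc; _+_; _≤_; s≤s⁻¹; z<s; _≤?_)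
import Data.Nat as ℕ
open import Data.Nat.Coprimality using (Coprime)
import Data.Nat.Properties as ℕ
open import Data.Nat.Tactic.RingSolver using (solve-∀)
open import Data.Integer using (+_; -[1+_])
import Data.Integer as ℤ
import Data.Integer.Properties as ℤ
open import Data.Rational using (ℚ; mkℚ; _/_; _*_; 0ℚ; toℚᵘ) renaming (_<_ to _<ℚ_)
import Data.Rational.Properties as ℚ
import Data.Rational.Unnormalised as ℚᵘ
import Data.Rational.Unnormalised.Properties as ℚᵘ
open import Data.Bool using (Bool; true; false)
import Data.Bool as Bool
open import Data.Bool.Properties using (¬-not)
open import Data.Product using (_×_; ∃-syntax; _,_; proj₁)
open import Data.Sum using (_⊎_; inj₁; inj₂)
open import Data.Fin using (Fin; zero; suc)
open import Data.Fin.Subset using (Subset; ∣_∣; _∩_; _∪_; ⁅_⁆; ⋃; Empty)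
import Data.Fin.Subset as Subset
import Data.Fin.Subset.Properties as Subset
import Data.Vec as Vec
open import Data.List using (List; []; _∷_; _++_; length; take; drop; concat; map; allFin)
open import Data.List.Properties
  using (length-take; length-drop; length-tabulate; take++drop≡id; drop-drop; ++-assoc)
open import Data.List.Membership.Propositional using (_∈_)
open import Data.List.Membership.Propositional.Properties using (∈-concat⁺′)
open import Data.List.Relation.Unary.Any using (here; there)
open import Data.List.Relation.Unary.All using (All; []; _∷_; lookup; tabulate)
open import Data.List.Relation.Unary.All.Properties using (All¬⇒¬Any)
  renaming (++⁻ˡ to All-++⁻ˡ; ++⁻ʳ to All-++⁻ʳ)
open import Data.List.Relation.Unary.AllPairs using (AllPairs; []; _∷_)
open import Data.List.Relation.Unary.Unique.Propositional using (Unique)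
open import Data.List.Relation.Unary.Unique.Propositional.Properties using (allFin⁺)
open import Data.List.Relation.Binary.Disjoint.Propositional using (Disjoint)
open import Data.List.Relation.Binary.Permutation.Propositional
  using (_↭_; ↭-refl; ↭-reflexive; ↭-sym; ↭-trans; ↭-prep; ↭-swap; ↭⇒↭ₛ)
open import Data.List.Relation.Binary.Permutation.Propositional.Properties using (shift; ++⁺ˡ)
open import Data.List.Relation.Binary.Permutation.Setoid.Properties using (Unique-resp-↭)
open import Function using (_∘_)
open import Relation.Nullary using (Dec; yes; no; contradiction)
open import Relation.Binary.PropositionalEquality
  using (_≡_; _≢_; refl; sym; trans; cong; subst; subst₂; setoid)

-- Windows of a list and changes of colour between them.

length-take-≤ : ∀ {A : Set} r (xs : List A) → r ≤ length xs → length (take r xs) ≡ r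
length-take-≤ r xs r≤ = trans (length-take r xs) (ℕ.m≤n⇒m⊓n≡m r≤)

≤-length-drop : ∀ {A : Set} r {k} (xs : List A) → r + k ≤ length xs → k ≤ length (drop r xs)
≤-length-drop zero    xs       h = h
≤-length-drop (suc r) (x ∷ xs) h = ≤-length-drop r xs (s≤s⁻¹ h)

-- The bound on `i` admits full windows only, since `take` truncates near the end of the list.
Window-constant : {A : Set} → (List A → Bool) → ℕ → List A → Bool → Set
Window-constant f r xs b = ∀ i → i + r ≤ length xs → f (take r (drop i xs)) ≡ b

-- Holds when two windows shifted by one have different colours: rest is then the
-- complement of their union, and y the element by which the union exceeds the
-- window of colour b.
Bichromatic : {A : Set} → (List A → Bool) → ℕ → List A → Set
Bichromatic f r xs = ∃[ rest ] (length xs ≡ suc r + length rest ×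
  (∀ b → ∃[ L ] ∃[ y ] (length L ≡ r × f L ≡ b × xs ↭ L ++ y ∷ rest)))

-- The two windows stay as they are; the new head joins their complement.
∷-Bichromatic : ∀ {A : Set} (f : List A → Bool) r x {xs} → Bichromatic f r xs → Bichromatic f r (x ∷ xs)
∷-Bichromatic f r x (rest , eq , pick) = x ∷ rest , trans (cong suc eq) (cong suc (sym (ℕ.+-suc r _))) , pick′
  where
  pick′ : ∀ b → ∃[ L ] ∃[ y ] (length L ≡ r × f L ≡ b × x ∷ _ ↭ L ++ y ∷ x ∷ rest)
  pick′ b with pick b
  ... | L , y , len , col , perm = L , y , len , col ,
    ↭-trans (↭-prep x perm) (↭-trans (↭-sym (shift x L (y ∷ rest))) (++⁺ˡ L (↭-swap x y ↭-refl)))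

drop-uncons : ∀ {A : Set} r x (xs : List A) → r ≤ length xs → ∃[ y ] (drop r (x ∷ xs) ≡ y ∷ drop r xs)
drop-uncons zero    x xs       _ = x , refl
drop-uncons (suc r) x (y ∷ xs) h = drop-uncons r y xs (s≤s⁻¹ h)

head-Bichromatic : ∀ {A : Set} (f : List A → Bool) r x xs → r ≤ length xs →
  f (take r (x ∷ xs)) ≢ f (take r xs) → Bichromatic f r (x ∷ xs)
head-Bichromatic f r x xs r≤ neq = drop r xs , len , pick
  where
  len : suc (length xs) ≡ suc r + length (drop r xs)
  len = cong suc (sym (trans (cong (_+_ r) (length-drop r xs)) (ℕ.m+[n∸m]≡n r≤)))
  pick : ∀ b → ∃[ L ] ∃[ y ] (length L ≡ r × f L ≡ b × x ∷ xs ↭ L ++ y ∷ drop r xs)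
  pick b with f (take r xs) Bool.≟ b
  ... | yes eq = take r xs , x , length-take-≤ r xs r≤ , eq ,
    ↭-trans (↭-prep x (↭-reflexive (sym (take++drop≡id r xs)))) (↭-sym (shift x (take r xs) (drop r xs)))
  -- The shifted window misses colour `b`, so the first one, differing from it, has colour `b`. Its
  -- complement in the union is the entry `y` at position `r`.
  ... | no ne with drop-uncons r x xs r≤
  ...   | y , eq = take r (x ∷ xs) , y , length-take-≤ r (x ∷ xs) (ℕ.m≤n⇒m≤1+n r≤) ,
    trans (¬-not neq) (sym (¬-not (ne ∘ sym))) ,
    ↭-reflexive (trans (sym (take++drop≡id r (x ∷ xs))) (cong (take r (x ∷ xs) ++_) eq))

-- If every window agrees in colour with the next one, the colour never changes along the list;
-- otherwise some consecutive pair disagrees.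
bichromatic-or-constant : ∀ {A : Set} (f : List A → Bool) r xs →
  Bichromatic f r xs ⊎ ∃[ b ] Window-constant f r xs b
bichromatic-or-constant f r [] = inj₂ (f (take r []) , λ { zero _ → refl ; (suc _) () })
bichromatic-or-constant f r (x ∷ xs) with bichromatic-or-constant f r xs
... | inj₁ bi = inj₁ (∷-Bichromatic f r x bi)
... | inj₂ (b , const) with r ≤? length xs
-- The tail has no full window, so the inductive `b` says nothing; the colour is read off at the
-- only possible start, 0.
...   | no r≰ = inj₂ (f (take r (x ∷ xs)) , λ
        { zero    _ → refl
        ; (suc i) h → contradiction (ℕ.≤-trans (ℕ.m≤n+m r i) (s≤s⁻¹ h)) r≰ })
...   | yes r≤ with f (take r (x ∷ xs)) Bool.≟ f (take r xs)
...     | no neq = inj₁ (head-Bichromatic f r x xs r≤ neq)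
...     | yes eq = inj₂ (b , λ
          { zero    _ → trans eq (const 0 r≤)
          ; (suc i) h → const i (s≤s⁻¹ h) })

-- Monochromatic families of disjoint blocks.

Mono-family : {A : Set} → (List A → Bool) → ℕ → ℕ → List A → Set
Mono-family f r k xs = ∃[ b ] ∃[ Ls ] ∃[ rest ] (length Ls ≡ k ×
  All (λ L → length L ≡ r × f L ≡ b) Ls × xs ↭ concat Ls ++ rest)

-- The colour is fixed in advance, not existential, so that the blocks cut off one after another
-- share it.
constant⇒Mono-family : ∀ {A : Set} (f : List A → Bool) r k xs b → k ℕ.* r ≤ length xs →
  Window-constant f r xs b →
  ∃[ Ls ] ∃[ rest ] (length Ls ≡ k × All (λ L → length L ≡ r × f L ≡ b) Ls × xs ↭ concat Ls ++ rest)
constant⇒Mono-family f r zero    xs b _ _ = [] , xs , refl , [] , ↭-refl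
constant⇒Mono-family f r (suc k) xs b h const
  with constant⇒Mono-family f r k (drop r xs) b (≤-length-drop r xs h)
         -- The window at `i` in the tail is the window at `r + i` in `xs`.
         (λ i i≤ → trans (cong (f ∘ take r) (drop-drop r i xs))
           (const (r + i) (subst (_≤ length xs) (sym (ℕ.+-assoc r i r)) (≤-drop i i≤))))
  where
  r≤ : r ≤ length xs
  r≤ = ℕ.≤-trans (ℕ.m≤m+n r (k ℕ.* r)) h
  ≤-drop : ∀ i → i + r ≤ length (drop r xs) → r + (i + r) ≤ length xs
  ≤-drop i i≤ = ℕ.≤-trans (ℕ.+-monoʳ-≤ r i≤)
    (ℕ.≤-reflexive (trans (cong (_+_ r) (length-drop r xs)) (ℕ.m+[n∸m]≡n r≤)))
... | Ls , rest , len , all , perm =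
  take r xs ∷ Ls , rest , cong suc len ,
  (length-take-≤ r xs (ℕ.≤-trans (ℕ.m≤m+n r (k ℕ.* r)) h) ,
   const 0 (ℕ.≤-trans (ℕ.m≤m+n r (k ℕ.* r)) h)) ∷ all ,
  ↭-trans (↭-reflexive (sym (take++drop≡id r xs)))
    (↭-trans (++⁺ˡ (take r xs) perm) (↭-reflexive (sym (++-assoc (take r xs) (concat Ls) rest))))

mono-family : ∀ {A : Set} (f : List A → Bool) r k xs →
  suc k ℕ.* r + k ≤ length xs → Mono-family f r (suc k) xs
mono-family f r k xs h with bichromatic-or-constant f r xs
... | inj₂ (b , const) = b , constant⇒Mono-family f r (suc k) xs b (ℕ.≤-trans (ℕ.m≤m+n _ k) h) const
-- A single block may have either colour; `true` is an arbitrary choice.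
mono-family f r zero xs h | inj₁ (rest , len , pick) with pick true
... | L , y , lenL , col , perm = true , L ∷ [] , y ∷ rest , refl , (lenL , col) ∷ [] ,
  ↭-trans perm (↭-reflexive (sym (++-assoc L [] (y ∷ rest))))
mono-family f r (suc k) xs h | inj₁ (rest , len , pick)
  -- Deleting `suc r` entries lowers the length by exactly the drop in the required bound.
  with mono-family f r k rest (ℕ.+-cancelˡ-≤ (suc r) _ _
         (ℕ.≤-trans (ℕ.≤-reflexive (rearrange r k)) (subst (_ ≤_) len h)))
  where
  rearrange : ∀ r k → suc r + (suc k ℕ.* r + k) ≡ suc (suc k) ℕ.* r + suc k
  rearrange = solve-∀
-- The recursion decides the colour `b` first; only then is the window of that colour picked. The
-- spare entry `y` goes to the leftovers.
... | b , Ls , rest′ , lenLs , all , perm with pick b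
...   | L , y , lenL , col , perm′ = b , L ∷ Ls , y ∷ rest′ , cong suc lenLs , (lenL , col) ∷ all ,
  ↭-trans perm′ (↭-trans (++⁺ˡ L (↭-trans (↭-prep y perm) (↭-sym (shift y (concat Ls) rest′))))
    (↭-reflexive (sym (++-assoc L (concat Ls) (y ∷ rest′)))))

-- From duplicate-free lists to subsets.

Unique-++⁻ : ∀ {A : Set} (xs : List A) {ys} → Unique (xs ++ ys) → Unique xs × Unique ys × Disjoint xs ys
Unique-++⁻ []       u       = [] , u , λ ()
Unique-++⁻ (x ∷ xs) {ys} (x∉ ∷ u) with Unique-++⁻ xs u
... | uxs , uys , disj = All-++⁻ˡ xs x∉ ∷ uxs , uys , λ
  { (here refl  , ∈ys) → lookup (All-++⁻ʳ xs x∉) ∈ys refl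
  ; (there ∈xs , ∈ys) → disj (∈xs , ∈ys) }

-- Extracts the disjointness that `Mono-family` encodes only through a permutation: an entry shared
-- by two blocks would occur twice in the concatenation.
Unique-concat⁻ : ∀ {A : Set} (Ls : List (List A)) → Unique (concat Ls) → All Unique Ls × AllPairs Disjoint Ls
Unique-concat⁻ []       _ = [] , []
Unique-concat⁻ (L ∷ Ls) u with Unique-++⁻ L u
... | uL , uLs , disj with Unique-concat⁻ Ls uLs
...   | all , pairs = uL ∷ all , tabulate (λ M∈ (x∈L , x∈M) → disj (x∈L , ∈-concat⁺′ x∈M M∈)) ∷ pairs

fromList : ∀ {n} → List (Fin n) → Subset n
fromList = ⋃ ∘ map ⁅_⁆

∈-fromList⁻ : ∀ {n} {x : Fin n} xs → x Subset.∈ fromList xs → x ∈ xs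
∈-fromList⁻ []       x∈ = contradiction x∈ Subset.∉⊥
∈-fromList⁻ (y ∷ ys) x∈ with Subset.x∈p∪q⁻ ⁅ y ⁆ (fromList ys) x∈
... | inj₁ x∈y  = here (Subset.x∈⁅y⁆⇒x≡y y x∈y)
... | inj₂ x∈ys = there (∈-fromList⁻ ys x∈ys)

∣⁅x⁆∪p∣ : ∀ {n} (x : Fin n) (p : Subset n) → x Subset.∉ p → ∣ ⁅ x ⁆ ∪ p ∣ ≡ suc ∣ p ∣
∣⁅x⁆∪p∣ zero    (true  Vec.∷ p) x∉ = contradiction Vec.here x∉
∣⁅x⁆∪p∣ zero    (false Vec.∷ p) x∉ = cong (suc ∘ ∣_∣) (Subset.∪-identityˡ p)
∣⁅x⁆∪p∣ (suc x) (true  Vec.∷ p) x∉ = cong suc (∣⁅x⁆∪p∣ x p (x∉ ∘ Vec.there))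
∣⁅x⁆∪p∣ (suc x) (false Vec.∷ p) x∉ = ∣⁅x⁆∪p∣ x p (x∉ ∘ Vec.there)

∣fromList∣ : ∀ {n} {xs : List (Fin n)} → Unique xs → ∣ fromList xs ∣ ≡ length xs
∣fromList∣ {n} []                     = Subset.∣⊥∣≡0 n
∣fromList∣ {xs = x ∷ xs} (x∉ ∷ u) =
  trans (∣⁅x⁆∪p∣ x (fromList xs) (All¬⇒¬Any x∉ ∘ ∈-fromList⁻ xs)) (cong suc (∣fromList∣ u))

fromList-disjoint : ∀ {n} {xs ys : List (Fin n)} → Disjoint xs ys → Empty (fromList xs ∩ fromList ys)
fromList-disjoint {xs = xs} {ys} disj (x , x∈) with Subset.x∈p∩q⁻ (fromList xs) (fromList ys) x∈
... | ∈xs , ∈ys = disj (∈-fromList⁻ xs ∈xs , ∈-fromList⁻ ys ∈ys)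

-- Sets of the wrong size get the junk colour false.
onSubsets : ∀ {n r} → (KVertex n r → Bool) → Subset n → Bool
onSubsets {r = r} f s with ∣ s ∣ ℕ.≟ r
... | yes eq = f (s , eq)
... | no  _  = false

onSubsets-vertex : ∀ {n r} (f : KVertex n r → Bool) (v : KVertex n r) → onSubsets f (proj₁ v) ≡ f v
onSubsets-vertex {r = r} f (s , eq) with ∣ s ∣ ℕ.≟ r
-- Equality proofs on naturals are irrelevant, so a vertex is determined by its set.
... | yes eq′ = cong (λ e → f (s , e)) (ℕ.≡-irrelevant eq′ eq)
... | no  ne  = contradiction eq ne

-- Monochromatic triangles in the Kneser graph.

monoTriangle-from-star : ∀ {n r} (c : EdgeColoring n r) → let open EdgeColoring c in
  ∀ {b} a u v w → KAdj a u → KAdj a v → KAdj a w → KAdj u v → KAdj v w → KAdj u w →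
  colour a u ≡ b → colour a v ≡ b → colour a w ≡ b → MonoTriangle c
monoTriangle-from-star c {b} a u v w au av aw uv vw uw cu cv cw =
  go (colour u v Bool.≟ b) (colour v w Bool.≟ b) (colour u w Bool.≟ b)
  where
  open EdgeColoring c
  go : Dec (colour u v ≡ b) → Dec (colour v w ≡ b) → Dec (colour u w ≡ b) → MonoTriangle c
  go (yes e) _ _ = a , u , v , au , uv , av , trans cu (sym e) , trans cu (sym cv)
  go (no _) (yes e) _ = a , v , w , av , vw , aw , trans cv (sym e) , trans cv (sym cw)
  go (no _) (no _) (yes e) = a , u , w , au , uw , aw , trans cu (sym e) , trans cu (sym cw)
  go (no p) (no q) (no s) = u , v , w , uv , vw , uw ,
    trans (¬-not p) (sym (¬-not q)) , trans (¬-not p) (sym (¬-not s))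

monoTriangle-from-list : ∀ {n r} (c : EdgeColoring n r) (xs : List (Fin n)) → Unique xs →
  r + (3 ℕ.* r + 2) ≤ length xs → MonoTriangle c
-- With `r` entries set aside for `A`, at least 3r + 2 remain: the bound of `mono-family` at k = 2,
-- which yields three blocks.
monoTriangle-from-list {n} {r} c xs u h = fromFamily (mono-family g r 2 (drop r xs) (≤-length-drop r xs h))
  where
  open EdgeColoring c
  A : List (Fin n)
  A = take r xs
  vertex : (L : List (Fin n)) → length L ≡ r → Unique L → KVertex n r
  vertex L len u = fromList L , trans (∣fromList∣ u) len
  lenA : length A ≡ r
  lenA = length-take-≤ r xs (ℕ.≤-trans (ℕ.m≤m+n r _) h)
  uA : Unique A
  uA = proj₁ (Unique-++⁻ A (subst Unique (sym (take++drop≡id r xs)) u))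
  a : KVertex n r
  a = vertex A lenA uA
  -- `mono-family` needs a colour for every list, while `colour a` accepts only r-sets; `onSubsets`
  -- bridges the gap.
  g : List (Fin n) → Bool
  g L = onSubsets (colour a) (fromList L)
  colour-g : ∀ {b} L (len : length L ≡ r) (u : Unique L) → g L ≡ b → colour a (vertex L len u) ≡ b
  colour-g L len u = trans (sym (onSubsets-vertex (colour a) (vertex L len u)))
  fromFamily : Mono-family g r 3 (drop r xs) → MonoTriangle c
  fromFamily (b , L₁ ∷ L₂ ∷ L₃ ∷ [] , rest , refl , (l₁ , c₁) ∷ (l₂ , c₂) ∷ (l₃ , c₃) ∷ [] , perm)
    -- Placing `A` in front of the three blocks gives all six disjoint pairs at once.
    with Unique-concat⁻ (A ∷ Ls) (proj₁ (Unique-++⁻ (concat (A ∷ Ls))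
           (Unique-resp-↭ (setoid _) (↭⇒↭ₛ perm′) u)))
    where
    Ls : List (List (Fin n))
    Ls = L₁ ∷ L₂ ∷ L₃ ∷ []
    perm′ : xs ↭ concat (A ∷ Ls) ++ rest
    perm′ = ↭-trans (↭-reflexive (sym (take++drop≡id r xs)))
      (↭-trans (++⁺ˡ A perm) (↭-reflexive (sym (++-assoc A (concat Ls) rest))))
  ... | _ ∷ u₁ ∷ u₂ ∷ u₃ ∷ [] , (dA₁ ∷ dA₂ ∷ dA₃ ∷ []) ∷ (d₁₂ ∷ d₁₃ ∷ []) ∷ (d₂₃ ∷ []) ∷ [] ∷ [] =
    monoTriangle-from-star c a (vertex L₁ l₁ u₁) (vertex L₂ l₂ u₂) (vertex L₃ l₃ u₃)
      (fromList-disjoint dA₁) (fromList-disjoint dA₂) (fromList-disjoint dA₃)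
      (fromList-disjoint d₁₂) (fromList-disjoint d₂₃) (fromList-disjoint d₁₃)
      (colour-g L₁ l₁ u₁ c₁) (colour-g L₂ l₂ u₂ c₂) (colour-g L₃ l₃ u₃ c₃)

kneser-arrows-triangle : ∀ n r → r + (3 ℕ.* r + 2) ≤ n → (c : EdgeColoring n r) → MonoTriangle c
kneser-arrows-triangle n r h c =
  monoTriangle-from-list c (allFin n) (allFin⁺ n) (subst (_ ≤_) (sym (length-tabulate (λ i → i))) h)

-- Choice of n and r for a given α.

*-denominator : ∀ p d .(cop : Coprime p (suc d)) → mkℚ (+ p) d cop * (+ (2 ℕ.* suc d) / 1) ≡ + (2 ℕ.* p) / 1
-- In the unnormalised rationals equality is cross-multiplication, so no gcd has to be computed.
*-denominator p d cop = ℚ.toℚᵘ-injective (begin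
  toℚᵘ (α * (+ n / 1))           ≈⟨ ℚ.toℚᵘ-homo-* α (+ n / 1) ⟩
  toℚᵘ α ℚᵘ.* toℚᵘ (+ n / 1)     ≈⟨ ℚᵘ.*-congˡ {toℚᵘ α} (ℚ.toℚᵘ-fromℚᵘ (ℚᵘ.mkℚᵘ (+ n) 0)) ⟩
  toℚᵘ α ℚᵘ.* ℚᵘ.mkℚᵘ (+ n) 0    ≈⟨ ℚᵘ.*≡* clear ⟩
  ℚᵘ.mkℚᵘ (+ (2 ℕ.* p)) 0        ≈⟨ ℚ.toℚᵘ-fromℚᵘ (ℚᵘ.mkℚᵘ (+ (2 ℕ.* p)) 0) ⟨
  toℚᵘ (+ (2 ℕ.* p) / 1)         ∎)
  where
  open ℚᵘ.≃-Reasoning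
  α : ℚ
  α = mkℚ (+ p) d cop
  n : ℕ
  n = 2 ℕ.* suc d
  clear-ℕ : ∀ p q → p ℕ.* (2 ℕ.* q) ℕ.* 1 ≡ 2 ℕ.* p ℕ.* (q ℕ.* 1)
  clear-ℕ = solve-∀
  clear : + p ℤ.* + n ℤ.* + 1 ≡ + (2 ℕ.* p) ℤ.* + (suc d ℕ.* 1)
  clear rewrite sym (ℤ.pos-* p n) | sym (ℤ.pos-* (p ℕ.* n) 1) | sym (ℤ.pos-* (2 ℕ.* p) (suc d ℕ.* 1)) =
    cong +_ (clear-ℕ p (suc d))

-- Integrality of αn for a positive n forces α to be rational, hence the quantification over `ℚ`.
theorem1p6 : (α : ℚ) → 0ℚ <ℚ α → α <ℚ (+ 1 / 4) →
    ∃[ n ] ∃[ r ] (0 < n × α * (+ n / 1) ≡ (+ r / 1) ×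
    ((c : EdgeColoring n r) → MonoTriangle c))
theorem1p6 (mkℚ -[1+ _ ] _ _) 0<α _ with ℚ.drop-*<* 0<α
... | ()
theorem1p6 (mkℚ (+ p) d cop) _ α<¼ =
  -- The strict inequality 4p < q leaves a slack of only 1; doubling both numbers raises it to the
  -- required 2.
  2 ℕ.* suc d , 2 ℕ.* p , z<s , *-denominator p d cop , kneser-arrows-triangle _ _ (begin
    2 ℕ.* p + (3 ℕ.* (2 ℕ.* p) + 2) ≡⟨ rearrange p ⟩
    2 ℕ.* suc (p ℕ.* 4)             ≤⟨ ℕ.*-monoʳ-≤ 2 4p<q ⟩
    2 ℕ.* suc d                     ∎)
  where
  open ℕ.≤-Reasoning
  rearrange : ∀ p → 2 ℕ.* p + (3 ℕ.* (2 ℕ.* p) + 2) ≡ 2 ℕ.* suc (p ℕ.* 4)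
  rearrange = solve-∀
  4p<q : p ℕ.* 4 < suc d
  4p<q = ℤ.drop‿+<+ (subst₂ ℤ._<_ (sym (ℤ.pos-* p 4)) (ℤ.*-identityˡ (+ suc d)) (ℚ.drop-*<* α<¼))
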